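{- Let $0<\epsilon'<\epsilon<\frac12$. Then for all positive integers $N,k$, $$R^{\mathrm{xor}}_{\epsilon'}\left(\mathrm{GapMaj}^\oplus[N,k,\epsilon]\right)\le O\left(N+\log\tfrac1{\epsilon'}\right),$$ with an absolute constant in the $O(\cdot)$ (in particular independent of $k$).
   Context: Gap Majority composed with XOR, $\mathrm{GapMaj}^\oplus[N,k,\epsilon]$: Alice receives $(X_1,\dots,X_N)$ and Bob $(Y_1,\dots,Y_N)$ with $X_i,Y_i\in\{0,1\}^k$, under the promise that there exists $z\in\{0,1\}^k$ with $|\{i\in[N]:X_i\oplus Y_i=z\}|\ge(1-\epsilon)N$ ($\oplus$ bitwise XOR); the required output is $z$. Two-party communication with private randomness $r_A,r_B$ and public randomness $r$; transcript $t_\pi$ = exchanged bits (public randomness excluded); cost = maximum number of bits exchanged. A protocol XOR-computes the problem with error $\epsilon'$ if there are maps $O_A(t_\pi,r,r_A,X)$, $O_B(t_\pi,r,r_B,Y)\in\{0,1\}^k$ such that for every input satisfying the promise, $\Pr[O_A\oplus O_B=z]\ge1-\epsilon'$. $R^{\mathrm{xor}}_{\epsilon'}$ is the minimum cost of such a protocol.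
   Formalization: The parameters ε and ε' are taken rational rather than real; log(1/ε') is expressed through any integer L with 2^(-L) ≤ ε', the cost bound being C(N+L) with an absolute constant C. -}

module Defs where

open import Data.Bool using (Bool; true; false; _xor_)
open import Data.Bool.Properties using () renaming (_≟_ to _≟ᵇ_)
open import Data.Nat using (ℕ; zero; suc; _+_; _*_; _^_; _≤_)
open import Data.Integer using (+_)
open import Data.List using (List; []; _∷_; map; concatMap; length; filter)
open import Data.Vec using (Vec; []; _∷_; zipWith; toList)
open import Data.Vec.Properties using (≡-dec)
open import Data.Product using (_×_; _,_; Σ; ∃)
open import Relation.Binary.PropositionalEquality using (_≡_)
open import Relation.Nullary using (Dec)
open import Data.Rational as ℚ using (ℚ; 0ℚ; 1ℚ; ½)

Bits : ℕ → Set
Bits k = Vec Bool k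

_⊕_ : ∀ {k} → Bits k → Bits k → Bits k
_⊕_ = zipWith _xor_

_≟bits_ : ∀ {k} (u v : Bits k) → Dec (u ≡ v)
_≟bits_ = ≡-dec _≟ᵇ_

allBits : (n : ℕ) → List (Bits n)
allBits zero    = [] ∷ []
allBits (suc n) = concatMap (λ v → (false ∷ v) ∷ (true ∷ v) ∷ []) (allBits n)

⟦_⟧ : ℕ → ℚ
⟦ n ⟧ = + n ℚ./ 1

agreeCount : ∀ {N k} → Vec (Bits k) N → Vec (Bits k) N → Bits k → ℕ
agreeCount X Y z = length (filter (λ w → w ≟bits z) (toList (zipWith _⊕_ X Y)))

GapMajPromise : (N k : ℕ) (ε : ℚ) → Vec (Bits k) N → Vec (Bits k) N → Bits k → Set
GapMajPromise N k ε X Y z = (1ℚ ℚ.- ε) ℚ.* ⟦ N ⟧ ℚ.≤ ⟦ agreeCount X Y z ⟧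

-- Two-party protocols.
-- 'Protocol A B c' is a protocol tree of depth at most c (i.e. at most c
-- bits are exchanged on every run).  At each internal node the speaker
-- (Alice or Bob) sends one bit computed from her/his full view,
-- of type A (resp. B), which here will be (public randomness, private
-- randomness, input); the tree structure encodes the dependence on the
-- transcript so far.

data Protocol (A B : Set) : ℕ → Set where
  halt  : ∀ {c} → Protocol A B c
  alice : ∀ {c} → (A → Bool) → (Bool → Protocol A B c) → Protocol A B (suc c)
  bob   : ∀ {c} → (B → Bool) → (Bool → Protocol A B c) → Protocol A B (suc c)

transcript : ∀ {A B c} → Protocol A B c → A → B → List Bool
transcript halt        a b = []
transcript (alice f k) a b = f a ∷ transcript (k (f a)) a b
transcript (bob g k)   a b = g b ∷ transcript (k (g b)) a b

-- A public+private coin protocol of cost at most c for inputs in XS / YS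
-- with outputs in Bits k.  Randomness: public r ∈ {0,1}^m, Alice's private
-- r_A ∈ {0,1}^mA, Bob's private r_B ∈ {0,1}^mB, all uniform and independent.
record RandProtocol (XS YS : Set) (k c : ℕ) : Set where
  field
    m mA mB : ℕ
    tree    : Protocol (Bits m × Bits mA × XS) (Bits m × Bits mB × YS) c
    outA    : List Bool → Bits m → Bits mA → XS → Bits k
    outB    : List Bool → Bits m → Bits mB → YS → Bits k

  xorOut : Bits m → Bits mA → Bits mB → XS → YS → Bits k
  xorOut r rA rB x y =
    let t = transcript tree (r , rA , x) (r , rB , y)
    in outA t r rA x ⊕ outB t r rB y

  goodCount : XS → YS → Bits k → ℕ
  goodCount x y z =
    length (filter (λ rrr → xorOut (Data.Product.proj₁ rrr)
                                   (Data.Product.proj₁ (Data.Product.proj₂ rrr))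
                                   (Data.Product.proj₂ (Data.Product.proj₂ rrr)) x y ≟bits z)
      (concatMap (λ r → concatMap (λ rA → map (λ rB → (r , rA , rB)) (allBits mB))
                                  (allBits mA))
                 (allBits m)))

  -- Pr_{r,r_A,r_B}[ O_A ⊕ O_B = z ] ≥ 1 - ε'   (cleared of denominators)
  SucceedsWith : ℚ → XS → YS → Bits k → Set
  SucceedsWith ε' x y z =
    (1ℚ ℚ.- ε') ℚ.* ⟦ 2 ^ (m + mA + mB) ⟧ ℚ.≤ ⟦ goodCount x y z ⟧

XorComputesGapMaj : (N k : ℕ) (ε ε' : ℚ) {c : ℕ} →
                    RandProtocol (Vec (Bits k) N) (Vec (Bits k) N) k c → Set
XorComputesGapMaj N k ε ε' P =
  ∀ X Y z → GapMajPromise N k ε X Y z → RandProtocol.SucceedsWith P ε' X Y z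

RxorGapMaj≤ : (N k : ℕ) (ε ε' : ℚ) (c : ℕ) → Set
RxorGapMaj≤ N k ε ε' c =
  Σ (RandProtocol (Vec (Bits k) N) (Vec (Bits k) N) k c) (XorComputesGapMaj N k ε ε')

{-# OPTIONS --safe #-}

-- Call x_i ⊕ y_i the label of index i; the promise makes z the label of a strict majority, and
-- once both players agree on an index with label z they output x_i and y_i.  Equality of labels
-- of i and j means x_i ⊕ x_j = y_i ⊕ y_j, so a list of indices can be tested for having a single
-- label by comparing 4-bit random linear hashes; such a test is wrong with probability 1/16 and
-- only by accepting.  The players run the Boyer–Moore cancellation: they keep a stack of
-- apparently equal indices and a pool.  A stack that is found inconsistent is popped back into
-- the pool; otherwise the next pool index is compared with the top, and the two are discarded
-- if they differ (which preserves the majority), or else the index is pushed.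
-- Let the gap be the size of the pool plus twice the number of pops that make the stack
-- consistent.  A round without test error lowers a positive gap, an error raises it by at most
-- one, so the expectation of 4^gap (0 at gap 0) halves in each round: 1/4 + 4 · 1/16 = 1/2.
-- Hence after 2 (N + L) rounds of 16 bits the gap is positive with probability at most
-- 4^N / 2^(2N + 2L) ≤ 2^(−L), and when it is 0 the stack consists of indices with label z.

module Submission where

open import Defs

module GapMajority where

  open import Data.Bool using (Bool; true; false; _∧_; _xor_; not; if_then_else_)
  open import Data.Bool.Properties using () renaming (_≟_ to _≟ᵇ_)
  open import Data.Fin using (Fin; zero; suc; _≟_)
  open import Data.List as List using (List; []; _∷_; length; map; filter; concatMap; allFin)
  open import Data.List.Properties using (length-tabulate; length-++; filter-++; filter-none)
  open import Data.List.Relation.Unary.All as All using (All; []; _∷_)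
  open import Data.List.Relation.Unary.Any using (there)
  open import Data.List.Membership.Propositional using (_∈_)
  open import Data.List.Membership.DecPropositional as DecMembership using ()
  open import Data.Nat hiding (_≟_)
  open import Data.Nat.ListAction using (sum)
  open import Data.Nat.Properties hiding (_≟_)
  open import Data.Nat.Tactic.RingSolver using (solve-∀)
  open import Data.Product using (Σ; _×_; _,_; proj₁; proj₂)
  open import Data.Unit using (⊤; tt)
  open import Data.Vec as Vec using (Vec; []; _∷_; take; drop; lookup; tabulate; concat; replicate)
  open import Data.Vec.Properties using (∷-injectiveˡ; ∷-injectiveʳ; ++-injective; tabulate-cong; lookup∘tabulate; lookup-zipWith)
  open import Function using (_∘_)
  open import Relation.Binary.PropositionalEquality
  open import Relation.Nullary using (¬_; Dec; yes; no; does; contradiction)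
  open import Relation.Nullary.Decidable using (dec-true; dec-false; decidable-stable)

  open ≤-Reasoning
  open module ∈-Fin {N} = DecMembership (_≟_ {N}) using (_∈?_)

  indicator : Bool → ℕ
  indicator b = if b then 1 else 0

  -- Sums over all bit strings

  sumBits : ∀ n → (Bits n → ℕ) → ℕ
  sumBits zero    f = f []
  sumBits (suc n) f = sumBits n (λ v → f (false ∷ v) + f (true ∷ v))

  sumBits-cong : ∀ n {f g : Bits n → ℕ} → (∀ v → f v ≡ g v) → sumBits n f ≡ sumBits n g
  sumBits-cong zero    f≡g = f≡g []
  sumBits-cong (suc n) f≡g = sumBits-cong n (λ v → cong₂ _+_ (f≡g (false ∷ v)) (f≡g (true ∷ v)))

  sumBits-mono : ∀ n {f g : Bits n → ℕ} → (∀ v → f v ≤ g v) → sumBits n f ≤ sumBits n g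
  sumBits-mono zero    f≤g = f≤g []
  sumBits-mono (suc n) f≤g = sumBits-mono n (λ v → +-mono-≤ (f≤g (false ∷ v)) (f≤g (true ∷ v)))

  sumBits-+ : ∀ n (f g : Bits n → ℕ) → sumBits n (λ v → f v + g v) ≡ sumBits n f + sumBits n g
  sumBits-+ zero    f g = refl
  sumBits-+ (suc n) f g = trans
    (sumBits-cong n (λ v → interchange (f (false ∷ v)) (g (false ∷ v)) (f (true ∷ v)) (g (true ∷ v))))
    (sumBits-+ n _ _)
    where
    interchange : ∀ a b c d → (a + b) + (c + d) ≡ (a + c) + (b + d)
    interchange = solve-∀

  sumBits-*ʳ : ∀ n (f : Bits n → ℕ) c → sumBits n (λ v → f v * c) ≡ sumBits n f * c
  sumBits-*ʳ zero    f c = refl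
  sumBits-*ʳ (suc n) f c = trans
    (sumBits-cong n (λ v → sym (*-distribʳ-+ c (f (false ∷ v)) (f (true ∷ v)))))
    (sumBits-*ʳ n _ c)

  sumBits-const : ∀ n c → sumBits n (λ _ → c) ≡ 2 ^ n * c
  sumBits-const zero    c = sym (+-identityʳ c)
  sumBits-const (suc n) c = trans (sumBits-const n (c + c)) (double (2 ^ n) c)
    where
    double : ∀ a c → a * (c + c) ≡ 2 * a * c
    double = solve-∀

  sumBits-split : ∀ a b (f : Bits (a + b) → ℕ) →
    sumBits (a + b) f ≡ sumBits a (λ u → sumBits b (λ v → f (u Vec.++ v)))
  sumBits-split zero    b f = refl
  sumBits-split (suc a) b f = trans (sumBits-split a b _)
    (sumBits-cong a (λ u → sumBits-+ b _ _))

  take-++ : ∀ {a b} (u : Bits a) (v : Bits b) → take a (u Vec.++ v) ≡ u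
  take-++ []      v = refl
  take-++ (x ∷ u) v = cong (x ∷_) (take-++ u v)

  drop-++ : ∀ {a b} (u : Bits a) (v : Bits b) → drop a (u Vec.++ v) ≡ v
  drop-++ []      v = refl
  drop-++ (x ∷ u) v = drop-++ u v

  -- Independence of two blocks of coins. The form with `take` and `drop` matches the way hashes and
  -- rounds consume their randomness.
  sumBits-take-drop : ∀ a b (f : Bits a → Bits b → ℕ) →
    sumBits (a + b) (λ w → f (take a w) (drop a w)) ≡ sumBits a (λ u → sumBits b (f u))
  sumBits-take-drop a b f = trans (sumBits-split a b _)
    (sumBits-cong a (λ u → sumBits-cong b (λ v → cong₂ f (take-++ u v) (drop-++ u v))))

  module _ {A : Set} {P : A → Set} (P? : ∀ a → Dec (P a)) where

    length-filter-∷ : ∀ a as → length (filter P? (a ∷ as)) ≡ indicator (does (P? a)) + length (filter P? as)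
    length-filter-∷ a as with does (P? a)
    ... | true  = refl
    ... | false = refl

    length-filter-concatMap : ∀ {B : Set} (f : B → List A) bs →
      length (filter P? (concatMap f bs)) ≡ sum (map (λ b → length (filter P? (f b))) bs)
    length-filter-concatMap f []       = refl
    length-filter-concatMap f (b ∷ bs) = trans (cong length (filter-++ P? (f b) (concatMap f bs)))
      (trans (length-++ (filter P? (f b))) (cong (length (filter P? (f b)) +_) (length-filter-concatMap f bs)))

  sum-allBits : ∀ n (f : Bits n → ℕ) → sum (map f (allBits n)) ≡ sumBits n f
  sum-allBits zero    f = +-identityʳ _
  sum-allBits (suc n) f = trans (go (allBits n)) (sum-allBits n _)
    where
    go : ∀ vs → sum (map f (concatMap (λ v → (false ∷ v) ∷ (true ∷ v) ∷ []) vs))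
              ≡ sum (map (λ v → f (false ∷ v) + f (true ∷ v)) vs)
    go []       = refl
    go (v ∷ vs) = trans (cong (λ s → f (false ∷ v) + (f (true ∷ v) + s)) (go vs))
      (sym (+-assoc (f (false ∷ v)) _ _))

  -- Random inner-product hashing

  innerProduct : ∀ {n} → Bits n → Bits n → Bool
  innerProduct []      []      = false
  innerProduct (a ∷ u) (b ∷ v) = (a ∧ b) xor innerProduct u v

  -- If the heads agree, the first bit of `u` shifts both products alike and the tails decide. If
  -- they differ, exactly one of the two values of that bit gives a collision, whatever the rest of
  -- `u` is.
  innerProduct-collision : ∀ {n} (x y : Bits n) → x ≢ y →
    sumBits n (λ u → indicator (does (innerProduct u x ≟ᵇ innerProduct u y))) * 2 ≡ 2 ^ n
  innerProduct-collision []      []      x≢y = contradiction refl x≢y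
  innerProduct-collision {suc n} (a ∷ x) (b ∷ y) x≢y = by-heads a b x≢y
    where
    same : Bits n → ℕ
    same u = indicator (does (innerProduct u x ≟ᵇ innerProduct u y))

    Goal : Bool → Bool → Set
    Goal a b = sumBits n (λ u → same u + indicator (does ((a xor innerProduct u x) ≟ᵇ (b xor innerProduct u y)))) * 2 ≡ 2 ^ suc n

    heads-equal : ∀ a → x ≢ y → Goal a a
    heads-equal a x≢y = begin-equality
      sumBits n _ * 2 ≡⟨ cong (_* 2) (sumBits-cong n (λ u → trans (cong (same u +_) (flip a _ _)) (double (same u)))) ⟩
      sumBits n (λ u → same u * 2) * 2 ≡⟨ cong (_* 2) (trans (sumBits-*ʳ n same 2) (innerProduct-collision x y x≢y)) ⟩
      2 ^ n * 2 ≡⟨ *-comm (2 ^ n) 2 ⟩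
      2 ^ suc n ∎
      where
      double : ∀ m → m + m ≡ m * 2
      double = solve-∀
      flip : ∀ a p q → indicator (does ((a xor p) ≟ᵇ (a xor q))) ≡ indicator (does (p ≟ᵇ q))
      flip false p     q     = refl
      flip true  false false = refl
      flip true  false true  = refl
      flip true  true  false = refl
      flip true  true  true  = refl

    heads-differ : ∀ a b → (∀ p q → indicator (does (p ≟ᵇ q)) + indicator (does ((a xor p) ≟ᵇ (b xor q))) ≡ 1) → Goal a b
    heads-differ a b one = begin-equality
      sumBits n _ * 2 ≡⟨ cong (_* 2) (trans (sumBits-cong n (λ u → one _ _)) (sumBits-const n 1)) ⟩
      2 ^ n * 1 * 2   ≡⟨ cong (_* 2) (*-identityʳ (2 ^ n)) ⟩
      2 ^ n * 2       ≡⟨ *-comm (2 ^ n) 2 ⟩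
      2 ^ suc n       ∎

    by-heads : ∀ a b → (a Vec.∷ x) ≢ (b ∷ y) → Goal a b
    by-heads false false ≢ = heads-equal false (≢ ∘ cong (false ∷_))
    by-heads true  true  ≢ = heads-equal true  (≢ ∘ cong (true ∷_))
    by-heads false true  ≢ = heads-differ false true λ where
      false false → refl
      false true  → refl
      true  false → refl
      true  true  → refl
    by-heads true  false ≢ = heads-differ true false λ where
      false false → refl
      false true  → refl
      true  false → refl
      true  true  → refl

  hash : ∀ c {n} → Bits (c * n) → Bits n → Bits c
  hash zero        u x = []
  hash (suc c) {n} u x = innerProduct (take n u) x ∷ hash c (drop n u) x

  collides : ∀ c {n} → Bits n → Bits n → Bits (c * n) → Bool
  collides c x y u = does (hash c u x ≟bits hash c u y)

  indicator-∧ : ∀ a b → indicator (a ∧ b) ≡ indicator b * indicator a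
  indicator-∧ false b     = sym (*-zeroʳ (indicator b))
  indicator-∧ true  b     = sym (*-identityʳ (indicator b))

  -- The `c` products use disjoint blocks of `u`, so their collision probabilities of 1/2 multiply.
  hash-collision : ∀ c {n} (x y : Bits n) → x ≢ y →
    sumBits (c * n) (indicator ∘ collides c x y) * 2 ^ c ≡ 2 ^ (c * n)
  hash-collision zero        x y x≢y = refl
  hash-collision (suc c) {n} x y x≢y = begin-equality
    sumBits (n + c * n) (indicator ∘ collides (suc c) x y) * 2 ^ suc c
      ≡⟨ cong (_* 2 ^ suc c) (sumBits-cong (n + c * n) (λ u → indicator-∧ (does (innerProduct (take n u) x ≟ᵇ innerProduct (take n u) y)) _)) ⟩
    sumBits (n + c * n) (λ u → indicator (collides c x y (drop n u)) * bit (take n u)) * 2 ^ suc c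
      ≡⟨ cong (_* 2 ^ suc c) (sumBits-take-drop n (c * n) (λ u v → indicator (collides c x y v) * bit u)) ⟩
    sumBits n (λ u → sumBits (c * n) (λ v → indicator (collides c x y v) * bit u)) * 2 ^ suc c
      ≡⟨ cong (_* 2 ^ suc c) (sumBits-cong n (λ u → trans (sumBits-*ʳ (c * n) _ (bit u)) (*-comm _ (bit u)))) ⟩
    sumBits n (λ u → bit u * rest) * 2 ^ suc c
      ≡⟨ cong (_* 2 ^ suc c) (sumBits-*ʳ n bit rest) ⟩
    sumBits n bit * rest * (2 * 2 ^ c)
      ≡⟨ rearrange (sumBits n bit) rest (2 ^ c) ⟩
    (sumBits n bit * 2) * (rest * 2 ^ c)
      ≡⟨ cong₂ _*_ (innerProduct-collision x y x≢y) (hash-collision c x y x≢y) ⟩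
    2 ^ n * 2 ^ (c * n)
      ≡⟨ ^-distribˡ-+-* 2 n (c * n) ⟨
    2 ^ (n + c * n) ∎
    where
    bit : Bits n → ℕ
    bit u = indicator (does (innerProduct u x ≟ᵇ innerProduct u y))
    rest : ℕ
    rest = sumBits (c * n) (indicator ∘ collides c x y)
    rearrange : ∀ a b d → a * b * (2 * d) ≡ (a * 2) * (b * d)
    rearrange = solve-∀

  -- Supermartingale weight

  -- The value at gap 0 is 0 and not `4 ^ 0`: a state of gap 0 never changes, so only a vanishing
  -- weight can halve there.
  weight : ℕ → ℕ
  weight zero    = 0
  weight (suc g) = 4 ^ suc g

  weight≤4^ : ∀ g → weight g ≤ 4 ^ g
  weight≤4^ zero    = z≤n
  weight≤4^ (suc g) = ≤-refl

  4*weight≤ : ∀ {g′ g} → g′ < g → 4 * weight g′ ≤ weight g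
  4*weight≤ {g′} {suc g} (s≤s g′≤g) = *-monoʳ-≤ 4 (≤-trans (weight≤4^ g′) (^-monoʳ-≤ 4 g′≤g))

  weight≤4* : ∀ {g′ g} → 0 < g → g′ ≤ suc g → weight g′ ≤ 4 * weight g
  weight≤4* {g′} {suc g} _ g′≤ = ≤-trans (weight≤4^ g′) (^-monoʳ-≤ 4 g′≤)

  -- Here `e` is the event of a test error and `W` the weight before the round. Outside `e` the new
  -- weight is at most W/4, on `e` at most 4W, and `e` has probability at most 1/16.
  average-halves : ∀ ω (f : Bits ω → ℕ) (e : Bits ω → Bool) (W : ℕ) →
    (∀ u → e u ≡ false → 4 * f u ≤ W) → (∀ u → f u ≤ 4 * W) →
    sumBits ω (indicator ∘ e) * 16 ≤ 2 ^ ω → 2 * sumBits ω f ≤ W * 2 ^ ω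
  average-halves ω f e W usual always rare = *-cancelˡ-≤ 2 (begin
    2 * (2 * sumBits ω f)                                ≡⟨ reorder₁ (sumBits ω f) ⟩
    sumBits ω f * 4                                      ≡⟨ sumBits-*ʳ ω f 4 ⟨
    sumBits ω (λ u → f u * 4)                            ≤⟨ sumBits-mono ω pointwise ⟩
    sumBits ω (λ u → W + indicator (e u) * (16 * W))     ≡⟨ sumBits-+ ω _ _ ⟩
    sumBits ω (λ _ → W) + sumBits ω (λ u → indicator (e u) * (16 * W))
      ≡⟨ cong₂ _+_ (sumBits-const ω W) (sumBits-*ʳ ω (indicator ∘ e) (16 * W)) ⟩
    2 ^ ω * W + sumBits ω (indicator ∘ e) * (16 * W)     ≡⟨ cong (2 ^ ω * W +_) (*-assoc (sumBits ω (indicator ∘ e)) 16 W) ⟨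
    2 ^ ω * W + sumBits ω (indicator ∘ e) * 16 * W       ≤⟨ +-monoʳ-≤ (2 ^ ω * W) (*-monoˡ-≤ W rare) ⟩
    2 ^ ω * W + 2 ^ ω * W                                ≡⟨ reorder₂ (2 ^ ω) W ⟩
    2 * (W * 2 ^ ω)                                      ∎)
    where
    reorder₁ : ∀ a → 2 * (2 * a) ≡ a * 4
    reorder₁ = solve-∀
    reorder₂ : ∀ a b → a * b + a * b ≡ 2 * (b * a)
    reorder₂ = solve-∀
    16W : ∀ a → 4 * a * 4 ≡ 16 * a + 0
    16W = solve-∀
    pointwise : ∀ u → f u * 4 ≤ W + indicator (e u) * (16 * W)
    pointwise u with e u in eq
    ... | false = ≤-trans (≤-reflexive (*-comm (f u) 4)) (≤-trans (usual u eq) (m≤m+n W 0))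
    ... | true  = ≤-trans (*-monoˡ-≤ 4 (always u)) (≤-trans (≤-reflexive (16W W)) (m≤n+m _ W))

  -- Cancelling pairs with a stack of apparently equal indices

  State : ℕ → Set
  State N = List (Fin N) × List (Fin N)

  stack : ∀ {N} → State N → List (Fin N)
  stack = proj₂

  -- With nothing to compare the list is empty, hence trivially homogeneous, and its test always
  -- passes.
  frontier : ∀ {N} → State N → List (Fin N)
  frontier (j ∷ _ , i ∷ _) = i ∷ j ∷ []
  frontier _               = []

  -- The Booleans are the outcomes of the tests of the stack and of the frontier.
  next : ∀ {N} → Bool → Bool → State N → State N
  next true  _     ([]    , s)     = [] , s
  next true  _     (j ∷ p , [])    = p , j ∷ []
  next true  true  (j ∷ p , i ∷ s) = p , j ∷ i ∷ s
  next true  false (j ∷ p , i ∷ s) = p , s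
  next false _     (p     , [])    = p , []
  next false _     (p     , i ∷ s) = i ∷ p , s

  initial : ∀ N → State N
  initial N = allFin N , []

  zeros : ∀ k → Bits k
  zeros k = replicate k false

  output : ∀ {N k} → State N → Vec (Bits k) N → Bits k
  -- A default value; at gap 0 a majority excludes the empty stack.
  output (_ , [])    X = zeros _
  output (_ , i ∷ _) X = lookup X i

  -- Slot `j` compares index `j` with the head of the list, and slots outside the list are zero for
  -- both players. The length is the same for all lists, so every test needs the same number of
  -- coins.
  differences : ∀ {N k} → List (Fin N) → Vec (Bits k) N → Bits (N * k)
  differences         []      X = zeros _
  differences {k = k} (i ∷ l) X =
    concat (tabulate λ j → if does (j ∈? (i ∷ l)) then lookup X j ⊕ lookup X i else zeros k)

  concat-injective : ∀ {N k} (U V : Vec (Bits k) N) → concat U ≡ concat V → U ≡ V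
  concat-injective []      []      _  = refl
  concat-injective (u ∷ U) (v ∷ V) eq =
    let eqˡ , eqʳ = ++-injective u v eq in cong₂ _∷_ eqˡ (concat-injective U V eqʳ)

  -- Translates between an equality of labels and an equality of differences, each of which one
  -- player can compute alone; it serves in both directions.
  ⊕-exchange : ∀ {k} (a b c d : Bits k) → a ⊕ b ≡ c ⊕ d → a ⊕ c ≡ b ⊕ d
  ⊕-exchange []      []      []      []      _  = refl
  ⊕-exchange (a ∷ u) (b ∷ v) (c ∷ w) (d ∷ x) eq =
    cong₂ _∷_ (bit a b c d (∷-injectiveˡ eq)) (⊕-exchange u v w x (∷-injectiveʳ eq))
    where
    bit : ∀ a b c d → a xor b ≡ c xor d → a xor c ≡ b xor d
    bit false false false false eq = refl
    bit false false true  true  eq = refl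
    bit false true  false true  eq = refl
    bit false true  true  false eq = refl
    bit true  false false true  eq = refl
    bit true  false true  false eq = refl
    bit true  true  false false eq = refl
    bit true  true  true  true  eq = refl

  if-cong : ∀ {P A : Set} (P? : Dec P) {a b c : A} → (P → a ≡ b) →
    (if does P? then a else c) ≡ (if does P? then b else c)
  if-cong (yes p) a≡b = a≡b p
  if-cong (no _)  a≡b = refl

  randomness : ℕ → ℕ → ℕ
  randomness N k = 4 * (N * k)

  -- Labels, homogeneous lists and the hash test

  module Analysis {N k : ℕ} (X Y : Vec (Bits k) N) where

    ω : ℕ
    ω = randomness N k

    label : Fin N → Bits k
    label j = lookup X j ⊕ lookup Y j

    Homogeneous : List (Fin N) → Set
    Homogeneous []      = ⊤
    Homogeneous (i ∷ l) = All (λ j → label j ≡ label i) l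

    homogeneous? : ∀ l → Dec (Homogeneous l)
    homogeneous? []      = yes tt
    homogeneous? (i ∷ l) = All.all? (λ j → label j ≟bits label i) l

    differences-≡ : ∀ l → Homogeneous l → differences l X ≡ differences l Y
    differences-≡ []      _   = refl
    differences-≡ (i ∷ l) hom = cong concat (tabulate-cong λ j →
      if-cong (j ∈? (i ∷ l)) (λ j∈ → ⊕-exchange _ _ _ _ (All.lookup (refl ∷ hom) j∈)))

    -- Equal vectors agree slot by slot, and the slots of members of the list give back the equality
    -- of their labels with that of the head.
    differences-≢ : ∀ l → ¬ Homogeneous l → differences l X ≢ differences l Y
    differences-≢ []      ¬hom _  = ¬hom tt
    differences-≢ (i ∷ l) ¬hom eq = ¬hom (All.tabulate λ {j} j∈l → ⊕-exchange _ _ _ _ (same j (there j∈l)))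
      where
      entry : Vec (Bits k) N → Fin N → Bits k
      entry Z j = if does (j ∈? (i ∷ l)) then lookup Z j ⊕ lookup Z i else zeros k
      select : ∀ Z j → j ∈ (i ∷ l) → entry Z j ≡ lookup Z j ⊕ lookup Z i
      select Z j j∈ = cong (if_then lookup Z j ⊕ lookup Z i else zeros k) (dec-true (j ∈? (i ∷ l)) j∈)
      same : ∀ j → j ∈ (i ∷ l) → lookup X j ⊕ lookup X i ≡ lookup Y j ⊕ lookup Y i
      same j j∈ = trans (sym (trans (lookup∘tabulate (entry X) j) (select X j j∈)))
        (trans (cong (λ V → lookup V j) (concat-injective (tabulate (entry X)) (tabulate (entry Y)) eq))
               (trans (lookup∘tabulate (entry Y) j) (select Y j j∈)))

    passes : List (Fin N) → Bits ω → Bool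
    passes l = collides 4 (differences l X) (differences l Y)

    passes-homogeneous : ∀ l u → Homogeneous l → passes l u ≡ true
    passes-homogeneous l u hom = dec-true (_ ≟bits _) (cong (hash 4 u) (differences-≡ l hom))

    passes-rarely : ∀ l → ¬ Homogeneous l → sumBits ω (indicator ∘ passes l) * 16 ≤ 2 ^ ω
    passes-rarely l ¬hom = ≤-reflexive (hash-collision 4 _ _ (differences-≢ l ¬hom))

    -- The number of pops that make the stack homogeneous.
    excess : List (Fin N) → ℕ
    excess []      = 0
    excess (i ∷ l) = if does (homogeneous? (i ∷ l)) then 0 else suc (excess l)

    excess-homogeneous : ∀ l → Homogeneous l → excess l ≡ 0
    excess-homogeneous []      _   = refl
    excess-homogeneous (i ∷ l) hom rewrite dec-true (homogeneous? (i ∷ l)) hom = refl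

    excess≡0⇒homogeneous : ∀ l → excess l ≡ 0 → Homogeneous l
    excess≡0⇒homogeneous []      _  = tt
    excess≡0⇒homogeneous (i ∷ l) eq with homogeneous? (i ∷ l)
    ... | yes hom = hom

    excess-pop : ∀ i l → ¬ Homogeneous (i ∷ l) → excess (i ∷ l) ≡ suc (excess l)
    excess-pop i l ¬hom rewrite dec-false (homogeneous? (i ∷ l)) ¬hom = refl

    excess-push-≤ : ∀ i l → excess (i ∷ l) ≤ suc (excess l)
    excess-push-≤ i l with does (homogeneous? (i ∷ l))
    ... | true  = z≤n
    ... | false = ≤-refl

    homogeneous-tail : ∀ i l → Homogeneous (i ∷ l) → Homogeneous l
    homogeneous-tail i []      _            = tt
    homogeneous-tail i (j ∷ l) (j≡i ∷ l≡i) = All.map (λ m≡i → trans m≡i (sym j≡i)) l≡i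

    excess-tail-≤ : ∀ i l → excess l ≤ excess (i ∷ l)
    excess-tail-≤ i l with homogeneous? (i ∷ l)
    ... | yes hom = ≤-reflexive (excess-homogeneous l (homogeneous-tail i l hom))
    ... | no  _   = n≤1+n _

    -- The factor 2 pays for a useful pop: it returns one index to the pool, so removing one unit of
    -- excess must outweigh that.
    gap : State N → ℕ
    gap (p , s) = length p + 2 * excess s

    -- A pop enlarges the pool by one and cannot raise the excess. A push adds at most one unit of
    -- excess, counted twice, while the pool loses an index. A discard raises neither term.
    next-gap-≤ : ∀ σ e₁ e₂ → gap (next e₁ e₂ σ) ≤ suc (gap σ)
    next-gap-≤ (p     , [])    false _     = n≤1+n _
    next-gap-≤ (p     , i ∷ s) false _     = s≤s (+-monoʳ-≤ (length p) (*-monoʳ-≤ 2 (excess-tail-≤ i s)))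
    next-gap-≤ ([]    , s)     true  _     = n≤1+n _
    next-gap-≤ (j ∷ p , [])    true  _     = m≤n⇒m≤1+n (n≤1+n _)
    next-gap-≤ (j ∷ p , i ∷ s) true  true  =
      ≤-trans (+-monoʳ-≤ (length p) (*-monoʳ-≤ 2 (excess-push-≤ j (i ∷ s)))) (≤-reflexive (shift (length p) _))
      where
      shift : ∀ a b → a + 2 * suc b ≡ suc (suc (a + 2 * b))
      shift = solve-∀
    next-gap-≤ (j ∷ p , i ∷ s) true  false =
      m≤n⇒m≤1+n (m≤n⇒m≤1+n (+-monoʳ-≤ (length p) (*-monoʳ-≤ 2 (excess-tail-≤ i s))))

    pop-gap-< : ∀ σ e → ¬ Homogeneous (stack σ) → gap (next false e σ) < gap σ
    pop-gap-< (p , [])    _ ¬hom = contradiction tt ¬hom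
    pop-gap-< (p , i ∷ s) _ ¬hom rewrite excess-pop i s ¬hom = ≤-reflexive (shift (length p) (excess s))
      where
      shift : ∀ a b → suc (suc (a + 2 * b)) ≡ a + 2 * suc b
      shift = solve-∀

    discard-gap-< : ∀ σ → ¬ Homogeneous (frontier σ) → gap (next true false σ) < gap σ
    discard-gap-< ([]    , s)     ¬hom = contradiction tt ¬hom
    discard-gap-< (j ∷ p , [])    ¬hom = contradiction tt ¬hom
    discard-gap-< (j ∷ p , i ∷ s) ¬hom = s≤s (+-monoʳ-≤ (length p) (*-monoʳ-≤ 2 (excess-tail-≤ i s)))

    push-gap-< : ∀ σ → Homogeneous (stack σ) → Homogeneous (frontier σ) → 0 < gap σ →
      gap (next true true σ) < gap σ
    -- A homogeneous stack over an empty pool has gap 0, which positivity rules out.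
    push-gap-< ([] , s) hom _ 0<gap rewrite excess-homogeneous s hom = contradiction 0<gap λ ()
    push-gap-< (j ∷ p , [])    _   _           _ = ≤-refl
    push-gap-< (j ∷ p , i ∷ s) hom (j≡i ∷ []) _
      rewrite excess-homogeneous (j ∷ i ∷ s) (sym j≡i ∷ All.map (λ m≡i → trans m≡i (sym j≡i)) hom)
      = s≤s (+-monoʳ-≤ (length p) z≤n)

    gap≡0 : ∀ σ → gap σ ≡ 0 → Σ (List (Fin N)) λ s → σ ≡ ([] , s) × Homogeneous s
    gap≡0 ([] , s) eq = s , refl , excess≡0⇒homogeneous s (m+n≡0⇒m≡0 (excess s) eq)

    -- Decay of the expected weight

    step : State N → Bits ω → State N
    step σ u = next (passes (stack σ) u) (passes (frontier σ) u) σ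

    weight-halves : ∀ σ → 2 * sumBits ω (λ u → weight (gap (step σ u))) ≤ weight (gap σ) * 2 ^ ω
    weight-halves σ with gap σ in eq
    -- With an empty pool and a homogeneous stack the stack test surely passes, so the state is
    -- fixed.
    ... | zero with s , refl , hom ← gap≡0 σ eq = ≤-reflexive (cong (2 *_)
          (trans (sumBits-cong ω unchanged) (trans (sumBits-const ω 0) (*-zeroʳ (2 ^ ω)))))
      where
      unchanged : ∀ u → weight (gap (step ([] , s) u)) ≡ 0
      unchanged u rewrite passes-homogeneous s u hom = cong weight eq
    ... | suc g = subst (λ n → 2 * sumBits ω (λ u → weight (gap (step σ u))) ≤ weight n * 2 ^ ω) eq
          (by-tests (homogeneous? (stack σ)) (homogeneous? (frontier σ)))
      where
      0<gap : 0 < gap σ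
      0<gap rewrite eq = z<s

      always : ∀ u → weight (gap (step σ u)) ≤ 4 * weight (gap σ)
      always u = weight≤4* 0<gap (next-gap-≤ σ (passes (stack σ) u) (passes (frontier σ) u))

      never : Bits ω → Bool
      never _ = false

      -- Only one test at a time can do harm: on an inhomogeneous stack a failed stack test forces a
      -- useful pop whatever the frontier test says, and on a homogeneous stack the stack test is
      -- certain to pass. Hence both tests may share the coins `u`.
      by-tests : Dec (Homogeneous (stack σ)) → Dec (Homogeneous (frontier σ)) →
        2 * sumBits ω (λ u → weight (gap (step σ u))) ≤ weight (gap σ) * 2 ^ ω
      by-tests (no ¬hom) _ = average-halves ω _ (passes (stack σ)) _ usual always (passes-rarely _ ¬hom)
        where
        usual : ∀ u → passes (stack σ) u ≡ false → 4 * weight (gap (step σ u)) ≤ weight (gap σ)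
        usual u fails rewrite fails = 4*weight≤ (pop-gap-< σ _ ¬hom)
      by-tests (yes hom) (no ¬hom) = average-halves ω _ (passes (frontier σ)) _ usual always (passes-rarely _ ¬hom)
        where
        usual : ∀ u → passes (frontier σ) u ≡ false → 4 * weight (gap (step σ u)) ≤ weight (gap σ)
        usual u fails rewrite passes-homogeneous (stack σ) u hom | fails = 4*weight≤ (discard-gap-< σ ¬hom)
      by-tests (yes hom) (yes hom′) = average-halves ω _ never _ usual always
          (≤-trans (≤-reflexive (cong (_* 16) (trans (sumBits-const ω 0) (*-zeroʳ (2 ^ ω))))) z≤n)
        where
        usual : ∀ u → never u ≡ false → 4 * weight (gap (step σ u)) ≤ weight (gap σ)
        usual u _ rewrite passes-homogeneous (stack σ) u hom | passes-homogeneous (frontier σ) u hom′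
          = 4*weight≤ (push-gap-< σ hom hom′ 0<gap)

    exec : ∀ T → State N → Bits (T * ω) → State N
    exec zero    σ r = σ
    exec (suc T) σ r = exec T (step σ (take ω r)) (drop ω r)

    total : ∀ T → State N → ℕ
    total T σ = sumBits (T * ω) (λ r → weight (gap (exec T σ r)))

    -- Condition on the coins of the first round, apply the induction hypothesis to each resulting
    -- state, and average with `weight-halves`.
    exec-weight : ∀ T σ → total T σ * 2 ^ T ≤ weight (gap σ) * 2 ^ (T * ω)
    exec-weight zero    σ = ≤-refl
    exec-weight (suc T) σ = begin
      total (suc T) σ * 2 ^ suc T
        ≡⟨ cong (_* 2 ^ suc T) (sumBits-take-drop ω (T * ω) (λ u v → weight (gap (exec T (step σ u) v)))) ⟩
      sumBits ω (total T ∘ step σ) * (2 * 2 ^ T)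
        ≡⟨ exchange (sumBits ω (total T ∘ step σ)) (2 ^ T) ⟩
      2 * (sumBits ω (total T ∘ step σ) * 2 ^ T)
        ≡⟨ cong (2 *_) (sumBits-*ʳ ω (total T ∘ step σ) (2 ^ T)) ⟨
      2 * sumBits ω (λ u → total T (step σ u) * 2 ^ T)
        ≤⟨ *-monoʳ-≤ 2 (sumBits-mono ω (exec-weight T ∘ step σ)) ⟩
      2 * sumBits ω (λ u → stepped u * 2 ^ (T * ω))
        ≡⟨ cong (2 *_) (sumBits-*ʳ ω stepped (2 ^ (T * ω))) ⟩
      2 * (sumBits ω stepped * 2 ^ (T * ω))
        ≡⟨ *-assoc 2 (sumBits ω stepped) (2 ^ (T * ω)) ⟨
      2 * sumBits ω stepped * 2 ^ (T * ω)
        ≤⟨ *-monoˡ-≤ (2 ^ (T * ω)) (weight-halves σ) ⟩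
      weight (gap σ) * 2 ^ ω * 2 ^ (T * ω)
        ≡⟨ *-assoc (weight (gap σ)) (2 ^ ω) (2 ^ (T * ω)) ⟩
      weight (gap σ) * (2 ^ ω * 2 ^ (T * ω))
        ≡⟨ cong (weight (gap σ) *_) (^-distribˡ-+-* 2 ω (T * ω)) ⟨
      weight (gap σ) * 2 ^ (ω + T * ω) ∎
      where
      stepped : Bits ω → ℕ
      stepped u = weight (gap (step σ u))
      exchange : ∀ a b → a * (2 * b) ≡ 2 * (a * b)
      exchange = solve-∀

    -- The majority invariant and the count of failures

    module _ (z : Bits k) where

      count : List (Fin N) → ℕ
      count l = length (filter (λ j → label j ≟bits z) l)

      hit : Fin N → ℕ
      hit j = indicator (does (label j ≟bits z))

      count-∷ : ∀ j l → count (j ∷ l) ≡ hit j + count l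
      count-∷ = length-filter-∷ (λ j → label j ≟bits z)

      Majority : State N → Set
      Majority (p , s) = length p + length s < 2 * (count p + count s)

      hit-distinct : ∀ i j → label j ≢ label i → hit j + hit i ≤ 1
      hit-distinct i j j≢i with label j ≟bits z | label i ≟bits z
      ... | yes j≡z | yes i≡z = contradiction (trans j≡z (sym i≡z)) j≢i
      ... | yes _   | no _    = ≤-refl
      ... | no _    | yes _   = ≤-refl
      ... | no _    | no _    = z≤n

      -- Pops and pushes only move indices. The hypothesis on `e₂` expresses that tests never reject
      -- wrongly, so a discarded pair has two different labels: the total drops by 2 and the doubled
      -- count of `z` by at most 2. Thus the invariant holds for all coins.
      next-majority : ∀ σ e₁ e₂ → (Homogeneous (frontier σ) → e₂ ≡ true) →
        Majority σ → Majority (next e₁ e₂ σ)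
      next-majority (p     , [])    false _ _ maj = maj
      next-majority (p     , i ∷ s) false _ _ maj
        rewrite count-∷ i p | count-∷ i s = subst₂ _<_
          (+-suc (length p) (length s)) (cong (2 *_) (swap (count p) (hit i) (count s))) maj
        where
        swap : ∀ a b c → a + (b + c) ≡ b + a + c
        swap = solve-∀
      next-majority ([]    , s)     true  _ _ maj = maj
      next-majority (j ∷ p , [])    true  _ _ maj
        rewrite count-∷ j p | count-∷ j [] = subst₂ _<_
          (shift (length p)) (swap (hit j) (count p)) maj
        where
        shift : ∀ a → suc (a + 0) ≡ a + 1
        shift = solve-∀
        swap : ∀ a b → 2 * (a + b + 0) ≡ 2 * (b + (a + 0))
        swap = solve-∀
      next-majority (j ∷ p , i ∷ s) true true _ maj
        rewrite count-∷ j p | count-∷ j (i ∷ s) = subst₂ _<_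
          (sym (+-suc (length p) (suc (length s)))) (cong (2 *_) (swap (hit j) (count p) (count (i ∷ s)))) maj
        where
        swap : ∀ a b c → a + b + c ≡ b + (a + c)
        swap = solve-∀
      next-majority (j ∷ p , i ∷ s) true false sound maj
        rewrite count-∷ j p | count-∷ i s = +-cancelˡ-< 2 _ _ (begin-strict
          2 + (length p + length s)                        ≡⟨ cong suc (+-suc (length p) (length s)) ⟨
          suc (length p + suc (length s))                  <⟨ maj ⟩
          2 * (hit j + count p + (hit i + count s))        ≡⟨ regroup (hit j) (count p) (hit i) (count s) ⟩
          2 * (hit j + hit i) + 2 * (count p + count s)
            ≤⟨ +-monoˡ-≤ _ (*-monoʳ-≤ 2 (hit-distinct i j λ j≡i → contradiction (sound (j≡i ∷ [])) λ ())) ⟩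
          2 + 2 * (count p + count s)                      ∎)
        where
        regroup : ∀ a b c d → 2 * (a + b + (c + d)) ≡ 2 * (a + c) + 2 * (b + d)
        regroup = solve-∀

      exec-majority : ∀ T σ r → Majority σ → Majority (exec T σ r)
      exec-majority zero    σ r maj = maj
      exec-majority (suc T) σ r maj = exec-majority T _ (drop ω r)
        (next-majority σ (passes (stack σ) (take ω r)) _ (passes-homogeneous (frontier σ) (take ω r)) maj)

      -- At gap 0 all remaining indices share one label; were it not `z`, the count of `z` would be
      -- 0 against a majority.
      output-correct : ∀ σ → gap σ ≡ 0 → Majority σ → output σ X ⊕ output σ Y ≡ z
      output-correct σ eq maj with gap≡0 σ eq
      ... | []    , refl , _   = contradiction maj λ ()
      ... | i ∷ s , refl , hom = decidable-stable (label i ≟bits z) λ i≢z → contradiction maj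
        (subst (λ l → ¬ suc (length s) < 2 * length l)
          (sym (filter-none (λ j → label j ≟bits z)
            (i≢z ∷ All.map (λ j≡i j≡z → i≢z (trans (sym j≡i) j≡z)) hom)))
          λ ())

      -- The enumeration `f` is arbitrary because the induction composes it with `suc`.
      count-tabulate : ∀ {n} (f : Fin n → Fin N) (V : Vec (Bits k) n) → (∀ i → label (f i) ≡ lookup V i) →
        count (List.tabulate f) ≡ length (filter (_≟bits z) (Vec.toList V))
      count-tabulate f []      _   = refl
      count-tabulate f (v ∷ V) f≡V = begin-equality
        count (List.tabulate f)                               ≡⟨ count-∷ (f zero) _ ⟩
        hit (f zero) + count (List.tabulate (f ∘ suc))
          ≡⟨ cong₂ _+_ (cong (λ w → indicator (does (w ≟bits z))) (f≡V zero)) (count-tabulate (f ∘ suc) V (f≡V ∘ suc)) ⟩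
        indicator (does (v ≟bits z)) + length (filter (_≟bits z) (Vec.toList V))
          ≡⟨ length-filter-∷ (_≟bits z) v (Vec.toList V) ⟨
        length (filter (_≟bits z) (v ∷ Vec.toList V))         ∎

      initial-majority : N < 2 * agreeCount X Y z → Majority (initial N)
      initial-majority maj = subst₂ _<_
        (sym (trans (+-identityʳ _) (length-tabulate {n = N} (λ i → i))))
        (cong (2 *_) (sym (trans (+-identityʳ _)
          (count-tabulate (λ i → i) (Vec.zipWith _⊕_ X Y) (λ i → sym (lookup-zipWith _⊕_ i X Y))))))
        maj

      wrong : State N → ℕ
      wrong σ = indicator (not (does ((output σ X ⊕ output σ Y) ≟bits z)))

      -- The pointwise form of Markov's inequality: errors occur only at positive gap, where the
      -- weight is at least 1.
      wrong≤weight : ∀ σ → Majority σ → wrong σ ≤ weight (gap σ)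
      wrong≤weight σ maj with gap σ in eq
      ... | zero  rewrite dec-true ((output σ X ⊕ output σ Y) ≟bits z) (output-correct σ eq maj) = z≤n
      ... | suc g = ≤-trans (indicator≤1 _) (m^n>0 4 (suc g))
        where
        indicator≤1 : ∀ b → indicator b ≤ 1
        indicator≤1 false = z≤n
        indicator≤1 true  = ≤-refl

      failures : ∀ L → N < 2 * agreeCount X Y z →
        let T = 2 * (N + L) in
        sumBits (T * ω) (wrong ∘ exec T (initial N)) * 2 ^ L ≤ 2 ^ (T * ω)
      failures L maj = *-cancelˡ-≤ (4 ^ N) ⦃ m^n≢0 4 N ⦄ (begin
        -- Of the decay `2 ^ T`, the factor `4 ^ N` cancels the initial weight; the remaining
        -- `4 ^ L` is weakened to `2 ^ L`.
        4 ^ N * (bad * 2 ^ L)            ≤⟨ *-monoʳ-≤ (4 ^ N) (*-monoʳ-≤ bad (^-monoʳ-≤ 2 (m≤m+n L (L + 0)))) ⟩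
        4 ^ N * (bad * 2 ^ (2 * L))      ≡⟨ regroup (4 ^ N) bad (2 ^ (2 * L)) ⟩
        bad * (4 ^ N * 2 ^ (2 * L))      ≡⟨ cong (λ p → bad * (p * 2 ^ (2 * L))) (^-*-assoc 2 2 N) ⟩
        bad * (2 ^ (2 * N) * 2 ^ (2 * L))  ≡⟨ cong (bad *_) (^-distribˡ-+-* 2 (2 * N) (2 * L)) ⟨
        bad * 2 ^ (2 * N + 2 * L)        ≡⟨ cong (λ e → bad * 2 ^ e) (*-distribˡ-+ 2 N L) ⟨
        bad * 2 ^ T                      ≤⟨ *-monoˡ-≤ (2 ^ T) (sumBits-mono (T * ω) λ r →
                                              wrong≤weight (exec T (initial N) r) (exec-majority T (initial N) r (initial-majority maj))) ⟩
        total T (initial N) * 2 ^ T      ≤⟨ exec-weight T (initial N) ⟩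
        weight (gap (initial N)) * 2 ^ (T * ω)  ≡⟨ cong (λ g → weight g * 2 ^ (T * ω))
                                                     (trans (+-identityʳ _) (length-tabulate {n = N} (λ i → i))) ⟩
        weight N * 2 ^ (T * ω)           ≤⟨ *-monoˡ-≤ (2 ^ (T * ω)) (weight≤4^ N) ⟩
        4 ^ N * 2 ^ (T * ω)              ∎)
        where
        T bad : ℕ
        T = 2 * (N + L)
        bad = sumBits (T * ω) (wrong ∘ exec T (initial N))
        regroup : ∀ a b c → a * (b * c) ≡ b * (a * c)
        regroup = solve-∀

  -- Simulation by a two-party protocol

  sendA : ∀ {A B c} n → (A → Bits n) → (Bits n → Protocol A B c) → Protocol A B (n + c)
  sendA zero    f κ = κ []
  sendA (suc n) f κ = alice (Vec.head ∘ f) λ b → sendA n (Vec.tail ∘ f) (κ ∘ (b ∷_))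

  sendB : ∀ {A B c} n → (B → Bits n) → (Bits n → Protocol A B c) → Protocol A B (n + c)
  sendB zero    g κ = κ []
  sendB (suc n) g κ = bob (Vec.head ∘ g) λ b → sendB n (Vec.tail ∘ g) (κ ∘ (b ∷_))

  -- Junk value zeros on lists shorter than n, which never occur in a transcript.
  readBits : ∀ n → List Bool → Bits n × List Bool
  readBits zero    t       = [] , t
  readBits (suc n) []      = zeros (suc n) , []
  readBits (suc n) (b ∷ t) = let v , t′ = readBits n t in b ∷ v , t′

  -- Both hashes are sent in full, so the outcome of the test is known to both players.
  query : ∀ {A B c} → (A → Bits 4) → (B → Bits 4) → (Bool → Protocol A B c) → Protocol A B (8 + c)
  query f g κ = sendA 4 f λ α → sendB 4 g λ β → κ (does (α ≟bits β))

  answer : List Bool → Bool × List Bool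
  answer t =
    let α , t₁ = readBits 4 t
        β , t₂ = readBits 4 t₁
    in does (α ≟bits β) , t₂

  -- The state depends on the inputs only through test outcomes, so each player recovers it from the
  -- transcript and both output at the same index.
  replay : ∀ {N} (T : ℕ) → State N → List Bool → State N
  replay zero    σ t = σ
  replay (suc T) σ t =
    let e₁ , t₁ = answer t
        e₂ , t₂ = answer t₁
    in replay T (next e₁ e₂ σ) t₂

  module _ {N k : ℕ} {A B : Set} (inA : A → Vec (Bits k) N) (inB : B → Vec (Bits k) N) where

    message : ∀ {C : Set} → (C → Vec (Bits k) N) → ∀ T → (C → Bits (suc T * randomness N k)) →
      List (Fin N) → C → Bits 4
    message input T coins l c = hash 4 (take (randomness N k) (coins c)) (differences l (input c))

    -- Each player reads the coins from a separate view; that they are public enters as the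
    -- hypothesis `rA a ≡ rB b` of `replay-rounds`. A round makes two queries of 8 bits.
    rounds : ∀ T → State N →
      (A → Bits (T * randomness N k)) → (B → Bits (T * randomness N k)) → Protocol A B (T * 16)
    rounds zero    σ rA rB = halt
    rounds (suc T) σ rA rB =
      query (message inA T rA (stack σ)) (message inB T rB (stack σ)) λ e₁ →
      query (message inA T rA (frontier σ)) (message inB T rB (frontier σ)) λ e₂ →
      rounds T (next e₁ e₂ σ) (drop (randomness N k) ∘ rA) (drop (randomness N k) ∘ rB)

    replay-rounds : ∀ T σ rA rB a b → rA a ≡ rB b →
      replay T σ (transcript (rounds T σ rA rB) a b) ≡ Analysis.exec (inA a) (inB b) T σ (rA a)
    replay-rounds zero    σ rA rB a b _  = refl
    -- The hashes have a literal length, so reading back the answers is a computation.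
    replay-rounds (suc T) σ rA rB a b eq = trans
      (replay-rounds T _ (drop ω ∘ rA) (drop ω ∘ rB) a b (cong (drop ω) eq))
      (cong (λ τ → exec T τ (drop ω (rA a))) one-step)
      where
      open Analysis (inA a) (inB b) using (ω; step; exec)

      agreement : List (Fin N) → Bits (suc T * ω) → Bool
      agreement l r = does (message inA T rA l a ≟bits hash 4 (take ω r) (differences l (inB b)))

      one-step : next (agreement (stack σ) (rB b)) (agreement (frontier σ) (rB b)) σ ≡ step σ (take ω (rA a))
      one-step = cong (λ r → next (agreement (stack σ) r) (agreement (frontier σ) r) σ) (sym eq)

  protocol : ∀ N k T → RandProtocol (Vec (Bits k) N) (Vec (Bits k) N) k (T * 16)
  protocol N k T = record
    { m    = T * randomness N k
    ; mA   = 0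
    ; mB   = 0
    ; tree = rounds (proj₂ ∘ proj₂) (proj₂ ∘ proj₂) T (initial N) proj₁ proj₁
    ; outA = λ t _ _ → output (replay T (initial N) t)
    ; outB = λ t _ _ → output (replay T (initial N) t)
    }

  module _ {N k : ℕ} (L : ℕ) (X Y : Vec (Bits k) N) (z : Bits k) where

    open Analysis X Y using (ω; exec; wrong; failures)

    private
      T : ℕ
      T = 2 * (N + L)

    open RandProtocol (protocol N k T) using (m; xorOut; goodCount)

    goodCount-sumBits : goodCount X Y z ≡
      sumBits m (λ r → indicator (does (xorOut r [] [] X Y ≟bits z)))
    -- Private coins have length 0, so each public string contributes a single triple.
    goodCount-sumBits = trans (length-filter-concatMap P? (λ r → (r , [] , []) ∷ []) (allBits m))
      (trans (sum-allBits m _) (sumBits-cong m λ r → trans (length-filter-∷ P? (r , [] , []) []) (+-identityʳ _)))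
      where
      P? : (rrr : Bits m × Bits 0 × Bits 0) → Dec (xorOut (proj₁ rrr) (proj₁ (proj₂ rrr)) (proj₂ (proj₂ rrr)) X Y ≡ z)
      P? (r , rA , rB) = xorOut r rA rB X Y ≟bits z

    badCount : ℕ
    badCount = sumBits m (wrong z ∘ exec T (initial N))

    badCount-rare : N < 2 * agreeCount X Y z → badCount * 2 ^ L ≤ 2 ^ m
    badCount-rare = failures z L

    -- `wrong` speaks of the executed states and `goodCount` of the protocol's outputs;
    -- `replay-rounds` identifies the two, which makes the events complementary.
    bad+good : badCount + goodCount X Y z ≡ 2 ^ m
    bad+good = begin-equality
      badCount + goodCount X Y z ≡⟨ cong (badCount +_) goodCount-sumBits ⟩
      badCount + sumBits m _     ≡⟨ sumBits-+ m _ _ ⟨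
      sumBits m _                ≡⟨ sumBits-cong m complementary ⟩
      sumBits m (λ _ → 1)        ≡⟨ sumBits-const m 1 ⟩
      2 ^ m * 1                  ≡⟨ *-identityʳ (2 ^ m) ⟩
      2 ^ m                      ∎
      where
      not+self : ∀ b → indicator (not b) + indicator b ≡ 1
      not+self false = refl
      not+self true  = refl
      View : Set
      View = Bits m × Bits 0 × Vec (Bits k) N
      complementary : ∀ r → wrong z (exec T (initial N) r) + indicator (does (xorOut r [] [] X Y ≟bits z)) ≡ 1
      complementary r = trans
        (cong (λ σ → wrong z (exec T (initial N) r) + indicator (does ((output σ X ⊕ output σ Y) ≟bits z)))
          (replay-rounds {A = View} {B = View} (proj₂ ∘ proj₂) (proj₂ ∘ proj₂) T (initial N) proj₁ proj₁
            (r , [] , X) (r , [] , Y) refl))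
        (not+self (does ((output (exec T (initial N) r) X ⊕ output (exec T (initial N) r) Y) ≟bits z)))

-- From rational thresholds to inequalities between natural numbers and back

module RationalBounds where

  open import Algebra.Properties.AbelianGroup using (xyx⁻¹≈y)
  open import Data.Integer as ℤ using (+_; +≤+)
  open import Data.Integer.Properties as ℤ using (drop‿+<+)
  open import Data.Nat as ℕ using (ℕ; suc)
  open import Data.Nat.Coprimality as Coprime using (1-coprimeTo)
  open import Data.Nat.Properties as ℕ using ()
  open import Data.Rational
  open import Data.Rational.Properties
  open import Relation.Binary.PropositionalEquality

  open ≤-Reasoning

  -- Exposes numerator and denominator, which the normalisation by a gcd hides for a variable `n`.
  ⟦⟧-mkℚ : ∀ n → ⟦ n ⟧ ≡ mkℚ (+ n) 0 (Coprime.sym (1-coprimeTo n))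
  ⟦⟧-mkℚ n = normalize-coprime (Coprime.sym (1-coprimeTo n))

  ⟦⟧-+ : ∀ m n → ⟦ m ℕ.+ n ⟧ ≡ ⟦ m ⟧ + ⟦ n ⟧
  ⟦⟧-+ m n = sym (trans (cong₂ _+_ (⟦⟧-mkℚ m) (⟦⟧-mkℚ n))
    (cong (_/ 1) (cong₂ ℤ._+_ (ℤ.*-identityʳ (+ m)) (ℤ.*-identityʳ (+ n)))))

  ⟦⟧-* : ∀ m n → ⟦ m ℕ.* n ⟧ ≡ ⟦ m ⟧ * ⟦ n ⟧
  ⟦⟧-* m n = sym (trans (cong₂ _*_ (⟦⟧-mkℚ m) (⟦⟧-mkℚ n)) (cong (_/ 1) (sym (ℤ.pos-* m n))))

  ⟦⟧-mono-≤ : ∀ {m n} → m ℕ.≤ n → ⟦ m ⟧ ≤ ⟦ n ⟧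
  ⟦⟧-mono-≤ {m} {n} m≤n = subst₂ _≤_ (sym (⟦⟧-mkℚ m)) (sym (⟦⟧-mkℚ n))
    (*≤* (ℤ.*-monoʳ-≤-nonNeg (+ 1) (+≤+ m≤n)))

  ⟦⟧-cancel-< : ∀ {m n} → ⟦ m ⟧ < ⟦ n ⟧ → m ℕ.< n
  ⟦⟧-cancel-< {m} {n} m<n with *<* lt ← subst₂ _<_ (⟦⟧-mkℚ m) (⟦⟧-mkℚ n) m<n =
    drop‿+<+ (ℤ.*-cancelʳ-<-nonNeg (+ 1) lt)

  -- As `N` is positive, `ε < ½` makes N/2 strictly smaller than (1 - ε) N; two copies of this are
  -- added.
  promise⇒majority : ∀ {ε} N a → 1 ℕ.≤ N → ε < ½ → (1ℚ - ε) * ⟦ N ⟧ ≤ ⟦ a ⟧ → N ℕ.< 2 ℕ.* a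
  promise⇒majority {ε} N@(suc _) a _ ε<½ promise = ⟦⟧-cancel-< (begin-strict
    ⟦ N ⟧                    ≡⟨ *-identityˡ ⟦ N ⟧ ⟨
    (½ + ½) * ⟦ N ⟧          ≡⟨ *-distribʳ-+ ⟦ N ⟧ ½ ½ ⟩
    ½ * ⟦ N ⟧ + ½ * ⟦ N ⟧    <⟨ +-mono-< half half ⟩
    ⟦ a ⟧ + ⟦ a ⟧            ≡⟨ ⟦⟧-+ a a ⟨
    ⟦ a ℕ.+ a ⟧              ≡⟨ cong (λ b → ⟦ a ℕ.+ b ⟧) (ℕ.+-identityʳ a) ⟨
    ⟦ 2 ℕ.* a ⟧              ∎)
    where
    half : ½ * ⟦ N ⟧ < ⟦ a ⟧
    -- `1ℚ - ½` evaluates to `½`.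
    half = <-≤-trans (*-monoˡ-<-pos ⟦ N ⟧ ⦃ normalize-pos N 1 ⦄ (+-monoʳ-< 1ℚ (neg-antimono-< ε<½))) promise

  -- The failure fraction is at most 1/2^L, and the hypothesis on `L` says that this is at most
  -- `ε′`.
  error-bound : ∀ {ε′} L bad good total → 0ℚ < ε′ → 1ℚ ≤ ε′ * ⟦ 2 ℕ.^ L ⟧ →
    bad ℕ.* 2 ℕ.^ L ℕ.≤ total → bad ℕ.+ good ≡ total → (1ℚ - ε′) * ⟦ total ⟧ ≤ ⟦ good ⟧
  error-bound {ε′} L bad good total 0<ε′ 1≤ε′2^L rare sum≡total = begin
    (1ℚ - ε′) * ⟦ total ⟧               ≡⟨ *-distribʳ-+ ⟦ total ⟧ 1ℚ (- ε′) ⟩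
    1ℚ * ⟦ total ⟧ + - ε′ * ⟦ total ⟧   ≡⟨ cong₂ _+_ (*-identityˡ ⟦ total ⟧) (sym (neg-distribˡ-* ε′ ⟦ total ⟧)) ⟩
    ⟦ total ⟧ - ε′ * ⟦ total ⟧          ≤⟨ +-monoʳ-≤ ⟦ total ⟧ (neg-antimono-≤ bad≤) ⟩
    ⟦ total ⟧ - ⟦ bad ⟧                 ≡⟨ cong (_- ⟦ bad ⟧) (trans (cong ⟦_⟧ (sym sum≡total)) (⟦⟧-+ bad good)) ⟩
    ⟦ bad ⟧ + ⟦ good ⟧ - ⟦ bad ⟧        ≡⟨ xyx⁻¹≈y +-0-abelianGroup ⟦ bad ⟧ ⟦ good ⟧ ⟩
    ⟦ good ⟧                            ∎
    where
    bad≤ : ⟦ bad ⟧ ≤ ε′ * ⟦ total ⟧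
    bad≤ = begin
      ⟦ bad ⟧                          ≡⟨ *-identityˡ ⟦ bad ⟧ ⟨
      1ℚ * ⟦ bad ⟧                     ≤⟨ *-monoʳ-≤-nonNeg ⟦ bad ⟧ ⦃ normalize-nonNeg bad 1 ⦄ 1≤ε′2^L ⟩
      ε′ * ⟦ 2 ℕ.^ L ⟧ * ⟦ bad ⟧       ≡⟨ *-assoc ε′ ⟦ 2 ℕ.^ L ⟧ ⟦ bad ⟧ ⟩
      ε′ * (⟦ 2 ℕ.^ L ⟧ * ⟦ bad ⟧)     ≡⟨ cong (ε′ *_) (trans (*-comm ⟦ 2 ℕ.^ L ⟧ ⟦ bad ⟧) (sym (⟦⟧-* bad (2 ℕ.^ L)))) ⟩
      ε′ * ⟦ bad ℕ.* 2 ℕ.^ L ⟧         ≤⟨ *-monoˡ-≤-nonNeg ε′ ⦃ nonNegative (<⇒≤ 0<ε′) ⦄ (⟦⟧-mono-≤ rare) ⟩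
      ε′ * ⟦ total ⟧                   ∎

-- The constant and the final bound

open import Data.Nat using (ℕ; _+_; _^_; _≥_) renaming (_*_ to _*ℕ_)
open import Data.Nat.Properties using (+-identityʳ; *-assoc; *-comm)
open import Data.Product using (Σ; _,_)
open import Data.Rational using (ℚ; 0ℚ; 1ℚ; ½; _<_; _≤_; _*_)
open import Relation.Binary.PropositionalEquality using (_≡_; cong; subst; sym; trans)
open GapMajority using (protocol; badCount; badCount-rare; bad+good)
open RationalBounds using (promise⇒majority; error-bound)

mainTheorem6 : Σ ℕ λ C →
    ∀ (ε ε' : ℚ) → 0ℚ < ε' → ε' < ε → ε < ½ →
    ∀ (N k : ℕ) → N ≥ 1 → k ≥ 1 →
    ∀ (L : ℕ) → 1ℚ ≤ ε' * ⟦ 2 ^ L ⟧ →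
    RxorGapMaj≤ N k ε ε' (C *ℕ (N + L))
-- There are `2 *ℕ (N + L)` rounds of 16 bits, and 2 · 16 = 32.
mainTheorem6 = 32 , λ ε ε' 0<ε' _ ε<½ N k N≥1 _ L 1≤ε'2^L →
  let T = 2 *ℕ (N + L)
      P = protocol N k T
      open RandProtocol P using (m; goodCount)
      -- Success is measured against all coins, including the two private strings of length 0.
      padding : 2 ^ m ≡ 2 ^ (m + 0 + 0)
      padding = cong (2 ^_) (sym (trans (+-identityʳ (m + 0)) (+-identityʳ m)))
  in subst (RxorGapMaj≤ N k ε ε') (trans (*-comm T 16) (sym (*-assoc 16 2 (N + L))))
       (P , λ X Y z promise → error-bound L (badCount L X Y z) (goodCount X Y z) (2 ^ (m + 0 + 0)) 0<ε' 1≤ε'2^L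
         (subst (badCount L X Y z *ℕ 2 ^ L Data.Nat.≤_) padding
           (badCount-rare L X Y z (promise⇒majority N (agreeCount X Y z) N≥1 ε<½ promise)))
         (trans (bad+good L X Y z) padding))
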